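{- Let $\mathfrak X$ be a topological space. Then the formula $AT_1$, i.e. $[\neq]p\to[\neq]\Box p$ (with $p$ a propositional letter), is valid in $\mathfrak X$ if and only if $\mathfrak X$ is a $T_1$-space.
   Context: Formulas are built by $\phi ::= p \mid \bot \mid \phi\to\phi \mid \Box\phi \mid [\neq]\phi$, with $p$ ranging over propositional letters. A valuation $\theta$ on a topological space $\mathfrak X$ assigns to each propositional letter a subset of $\mathfrak X$. Truth at a point is defined by: $\mathfrak X,\theta,x\models p$ iff $x\in\theta(p)$; $\bot$ is never true; $\to$ is interpreted classically; $\mathfrak X,\theta,x\models\Box\phi$ iff there is a neighborhood $U$ of $x$ with $\mathfrak X,\theta,y\models\phi$ for all $y\in U$; $\mathfrak X,\theta,x\models[\neq]\phi$ iff $\mathfrak X,\theta,y\models\phi$ for all $y\neq x$. A formula is valid in $\mathfrak X$ if it is true at every point under every valuation. A $T_1$-space is a topological space in which all one-element subsets are closed. -}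

module Defs where

open import Level using (Level; _⊔_; suc; Lift)
open import Data.Empty.Polymorphic using (⊥)
open import Data.Unit.Polymorphic using (⊤)
open import Data.Product using (_×_; ∃-syntax)
open import Relation.Binary.PropositionalEquality using (_≢_)
open import Relation.Unary using (Pred; _∈_; _⊆_; _≐_; _∩_; ⋃; ∁; ｛_｝)

private
  variable
    v ℓ o : Level

-- Subsets are predicates, so `Open` is required to respect extensional
-- equality of subsets.  The empty set is open as the union over an empty index.
record TopologicalSpace (ℓ o : Level) : Set (suc (ℓ ⊔ o)) where
  field
    Point      : Set ℓ
    Open       : Pred (Pred Point ℓ) o
    Open-resp  : ∀ {A B} → A ≐ B → Open A → Open B
    Open-X     : Open (λ _ → ⊤)
    Open-∩     : ∀ {A B} → Open A → Open B → Open (A ∩ B)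
    Open-⋃     : ∀ (I : Set ℓ) (F : I → Pred Point ℓ) →
                 (∀ i → Open (F i)) → Open (⋃ I F)

  Closed : Pred (Pred Point ℓ) o
  Closed A = Open (∁ A)

  -- Neighbourhoods need not themselves be open.
  Neighbourhood : Point → Pred (Pred Point ℓ) (suc ℓ ⊔ o)
  Neighbourhood x N = ∃[ V ] Open V × x ∈ V × V ⊆ N

open TopologicalSpace

IsT₁ : TopologicalSpace ℓ o → Set (ℓ ⊔ o)
IsT₁ 𝔛 = ∀ (x : Point 𝔛) → Closed 𝔛 ｛ x ｝

infixr 5 _⇒_
infix  8 □_ [≠]_

data Formula (Var : Set v) : Set v where
  var  : Var → Formula Var
  ⊥′   : Formula Var
  _⇒_  : Formula Var → Formula Var → Formula Var
  □_   : Formula Var → Formula Var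
  [≠]_ : Formula Var → Formula Var

Valuation : Set v → TopologicalSpace ℓ o → Set (v ⊔ suc ℓ)
Valuation {ℓ = ℓ} Var 𝔛 = Var → Pred (Point 𝔛) ℓ

-- `True 𝔛 θ x φ` is 𝔛,θ,x ⊨ φ.  The □ clause quantifies over subsets, which
-- forces the universe level of the whole relation; hence the `Lift` for letters.
True : {Var : Set v} (𝔛 : TopologicalSpace ℓ o) → Valuation Var 𝔛 →
       Point 𝔛 → Formula Var → Set (suc ℓ ⊔ o)
True {ℓ = ℓ} {o = o} 𝔛 θ x (var p) = Lift (suc ℓ ⊔ o) (x ∈ θ p)
True 𝔛 θ x ⊥′       = ⊥
True 𝔛 θ x (φ ⇒ ψ)  = True 𝔛 θ x φ → True 𝔛 θ x ψ
True 𝔛 θ x (□ φ)    = ∃[ N ] Neighbourhood 𝔛 x N × (∀ y → y ∈ N → True 𝔛 θ y φ)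
True 𝔛 θ x ([≠] φ)  = ∀ y → y ≢ x → True 𝔛 θ y φ

Valid : {Var : Set v} → TopologicalSpace ℓ o → Formula Var → Set (v ⊔ suc ℓ ⊔ o)
Valid {Var = Var} 𝔛 φ = ∀ (θ : Valuation Var 𝔛) (x : Point 𝔛) → True 𝔛 θ x φ

AT₁ : {Var : Set v} → Var → Formula Var
AT₁ p = [≠] var p ⇒ [≠] □ var p

{-# OPTIONS --safe #-}
module Submission where

open import Defs
open import Level using (lift; lower)
open import Data.Product using (Σ-syntax; _,_; proj₁; proj₂)
open import Function.Bundles using (_⇔_; mk⇔)
open import Relation.Binary.PropositionalEquality using (_≢_; ≢-sym)
open import Relation.Unary using (∁; ｛_｝; _∈_)

open TopologicalSpace

-- At x, `[≠] var p` says that p holds on `∁ ｛ x ｝`. If this set is open, it is a neighbourhood of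
-- each of its points on which p holds. Conversely, letting p denote exactly this set makes it a
-- neighbourhood of each of its points, hence open.

T₁⇒AT₁ : ∀ {v ℓ o} {Var : Set v} (p : Var) (𝔛 : TopologicalSpace ℓ o) →
         IsT₁ 𝔛 → Valid 𝔛 (AT₁ p)
T₁⇒AT₁ p 𝔛 t₁ θ x [≠]p y y≢x =
  ∁ ｛ x ｝ , (∁ ｛ x ｝ , t₁ x , ≢-sym y≢x , λ z∈ → z∈) , λ z x≢z → [≠]p z (≢-sym x≢z)

-- Choosing an open V for every point of A is legitimate constructively because
-- a neighbourhood carries its open subset as data.
open-if-neighbourhoods : ∀ {ℓ o} (𝔛 : TopologicalSpace ℓ o) {A} →
                         (∀ y → y ∈ A → Neighbourhood 𝔛 y A) → Open 𝔛 A
open-if-neighbourhoods 𝔛 {A} nbhd =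
  Open-resp 𝔛
    ( (λ { ((y , y∈A) , z∈V) → proj₂ (proj₂ (proj₂ (nbhd y y∈A))) z∈V })
    , (λ {y} y∈A → (y , y∈A) , proj₁ (proj₂ (proj₂ (nbhd y y∈A)))) )
    (Open-⋃ 𝔛 (Σ[ y ∈ Point 𝔛 ] y ∈ A)
      (λ (y , y∈A) → proj₁ (nbhd y y∈A))
      (λ (y , y∈A) → proj₁ (proj₂ (nbhd y y∈A))))

-- Under the valuation p ↦ ∁ ｛ x ｝ the premise [≠]p holds at x, and [≠]□p there
-- says that ∁ ｛ x ｝ is a neighbourhood of each of its points.
AT₁⇒T₁ : ∀ {v ℓ o} {Var : Set v} (p : Var) (𝔛 : TopologicalSpace ℓ o) →
         Valid 𝔛 (AT₁ p) → IsT₁ 𝔛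
AT₁⇒T₁ p 𝔛 valid x = open-if-neighbourhoods 𝔛 nbhd
  where
  nbhd : ∀ y → x ≢ y → Neighbourhood 𝔛 y (∁ ｛ x ｝)
  nbhd y x≢y with valid (λ _ → ∁ ｛ x ｝) x (λ z z≢x → lift (≢-sym z≢x)) y (≢-sym x≢y)
  ... | N , (V , V-open , y∈V , V⊆N) , N⊆∁x =
    -- N may be smaller than `∁ ｛ x ｝`; the same V serves since V ⊆ N ⊆ `∁ ｛ x ｝`.
    V , V-open , y∈V , λ {z} z∈V → lower (N⊆∁x z (V⊆N z∈V))

lemma3p5 : ∀ {v ℓ o} {Var : Set v} (p : Var) (𝔛 : TopologicalSpace ℓ o) →
    Valid 𝔛 (AT₁ p) ⇔ IsT₁ 𝔛
lemma3p5 p 𝔛 = mk⇔ (AT₁⇒T₁ p 𝔛) (T₁⇒AT₁ p 𝔛)
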